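{- Let $W$ be a finite reflection group of type A, B or D acting on $V=\mathbb{R}^\ell$, that is, $W=W^A$ or $W=W^B$ with $\ell\ge2$, or $W=W^D$ with $\ell\ge 4$, and let $\mathscr{A}$ be the corresponding reflection arrangement ($\mathcal{A}_{\ell-1}$, $\mathcal{B}_\ell$ or $\mathcal{D}_\ell$ respectively). Then the $S$-module $D^{(2)}(\mathscr{A})$ cannot have bases (over $S$) consisting of only $W$-invariant elements.
   Context: $S=\mathbb{R}[x_1,\dots,x_\ell]$ is the ring of polynomial functions on $V=\mathbb{R}^\ell$, $\partial_i=\partial/\partial x_i$, and $D^{(2)}(S)=\bigoplus_{|\alpha|=2}S\,\partial^\alpha$ (multi-indices $\alpha\in\mathbb{N}^\ell$ with $\alpha_1+\cdots+\alpha_\ell=2$). For a central arrangement $\mathscr{A}$ with defining polynomial $Q$, $D^{(2)}(\mathscr{A})=\{\theta\in D^{(2)}(S)\mid\theta(QS)\subseteq QS\}$. Here $Q(\mathcal{A}_{\ell-1})=\prod_{i<j}(x_i-x_j)$, $Q(\mathcal{B}_\ell)=x_1\cdots x_\ell\prod_{i<j}(x_i^2-x_j^2)$, $Q(\mathcal{D}_\ell)=\prod_{i<j}(x_i^2-x_j^2)$. The groups are $W^A=\mathfrak{S}_\ell$ (permuting the coordinates of $\mathbb{R}^\ell$), $W^B=\mathfrak{S}_\ell\ltimes(\mathbb{Z}/2\mathbb{Z})^\ell$ (permutations and arbitrary sign changes of coordinates), and $W^D=\mathfrak{S}_\ell\ltimes(\mathbb{Z}/2\mathbb{Z})^{\ell-1}$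 (permutations and sign changes of an even number of coordinates). $W$ acts on $S$ by $(w\cdot f)(v)=f(w^{ -1}v)$ and on $D^{(2)}(S)$ by $(w\cdot\theta)(f)=w\cdot(\theta(w^{ -1}\cdot f))$; an element $\theta$ is $W$-invariant if $w\cdot\theta=\theta$ for all $w\in W$. -}

module Defs where

open import Algebra.Bundles using (CommutativeRing)
open import Algebra.Module.Bundles using (Module)
open import Algebra.Module.Structures using (IsLeftModule)
open import Algebra.Module.Structures.Biased using (IsModuleFromLeft)
import Algebra.Properties.CommutativeMonoid.Sum as MonoidSum
import Algebra.Properties.Ring as RingProperties
import Algebra.Properties.Semiring.Divisibility as Divisibility
import Algebra.Solver.Ring.NaturalCoefficients.Default as SemiringSolver
open import Data.Bool.Base using (if_then_else_; true; false)
import Data.Empty as Empty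
open import Data.Fin.Base using (Fin)
open import Data.Fin.Permutation as Perm
  using (Permutation′; _⟨$⟩ʳ_; _⟨$⟩ˡ_; inverseʳ)
open import Data.Fin.Properties using (_≟_; _<?_)
open import Data.Fin.Subset using (Subset; ⊥; ∣_∣)
open import Data.List.Base as List using (List; []; _∷_; _++_; allFin)
open import Data.List.Membership.Propositional using (_∈_)
open import Data.List.Membership.Propositional.Properties 
  using (∈-map⁺; ∈-map⁻; ∈-++⁺ˡ; ∈-++⁺ʳ)
open import Data.List.Relation.Unary.Any using (here)
open import Data.List.Relation.Unary.AllPairs using ([]; _∷_)
open import Data.List.Relation.Unary.All using ([])
open import Data.List.Relation.Unary.Unique.Propositional using (Unique)
import Data.List.Relation.Unary.Unique.Propositional.Properties as Unique
open import Data.Nat.Base as ℕ using (ℕ; zero; suc; _⊔_)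
open import Data.Nat.Divisibility using (_∣_)
open import Data.Nat.GeneralisedArithmetic using (fold)
import Data.Nat.Properties as ℕ
open import Data.Product.Base using (Σ; ∃; _×_; _,_; proj₁; proj₂)
open import Data.Rational.Base as ℚ using (ℚ; 0ℚ; 1ℚ; ½)
import Data.Rational.Properties as ℚ
import Data.Rational.Solver as ℚ
open import Data.Unit.Base using (⊤)
open import Data.Vec.Base as Vec using (Vec; []; _∷_; lookup; tabulate)
open import Data.Vec.Functional using (Vector)
open import Data.Vec.Properties using (lookup∘tabulate)
open import Function.Base using (_∘_; flip)
open import Function.Definitions using (Injective)
open import Level using (0ℓ) renaming (_⊔_ to _⊔ˡ_)
open import Relation.Binary.PropositionalEquality.Core as ≡ using (_≡_; refl)
open import Relation.Binary.Structures using (IsEquivalence)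
open import Relation.Nullary.Decidable.Core using (does)

------------------------------------------------------------------------
-- The real numbers, as Cauchy sequences of rationals (with a modulus)
-- modulo null sequences.

record ℝ : Set where
  field
    seq    : ℕ → ℚ
    cauchy : ∀ ε → 0ℚ ℚ.< ε →
             ∃ λ N → ∀ m n → N ℕ.≤ m → N ℕ.≤ n → ℚ.∣ seq m ℚ.- seq n ∣ ℚ.< ε

open ℝ public

infix 4 _≈ℝ_

_≈ℝ_ : ℝ → ℝ → Set
x ≈ℝ y = ∀ ε → 0ℚ ℚ.< ε →
         ∃ λ N → ∀ n → N ℕ.≤ n → ℚ.∣ seq x n ℚ.- seq y n ∣ ℚ.< ε

module RealArithmetic where

  private
    module Identities where
      open ℚ.+-*-Solver

      opp : ∀ a b → ℚ.- (a ℚ.- b) ≡ b ℚ.- a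
      opp = solve 2 (λ a b → :- (a :- b) := b :- a) refl

      neg-sub : ∀ a b → ℚ.- (a ℚ.- b) ≡ (ℚ.- a) ℚ.- (ℚ.- b)
      neg-sub = solve 2 (λ a b → :- (a :- b) := (:- a) :- (:- b)) refl

      telescope : ∀ a b c → (a ℚ.- b) ℚ.+ (b ℚ.- c) ≡ a ℚ.- c
      telescope = solve 3 (λ a b c → (a :- b) :+ (b :- c) := a :- c) refl

      split : ∀ a b → a ≡ (a ℚ.- b) ℚ.+ b
      split = solve 2 (λ a b → a := (a :- b) :+ b) refl

      add-sub : ∀ a b c d → (a ℚ.- b) ℚ.+ (c ℚ.- d) ≡ (a ℚ.+ c) ℚ.- (b ℚ.+ d)
      add-sub = solve 4 (λ a b c d → (a :- b) :+ (c :- d) := (a :+ c) :- (b :+ d)) refl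

      mul-sub : ∀ a b c d → a ℚ.* (c ℚ.- d) ℚ.+ d ℚ.* (a ℚ.- b) ≡ a ℚ.* c ℚ.- b ℚ.* d
      mul-sub = solve 4 (λ a b c d → a :* (c :- d) :+ d :* (a :- b) := a :* c :- b :* d) refl

      left-comm : ∀ a b c → a ℚ.* (b ℚ.* c) ≡ b ℚ.* (a ℚ.* c)
      left-comm = solve 3 (λ a b c → a :* (b :* c) := b :* (a :* c)) refl

    open Identities

  Small : (ℕ → ℕ → ℚ) → Set
  Small u = ∀ ε → 0ℚ ℚ.< ε →
            ∃ λ N → ∀ m n → N ℕ.≤ m → N ℕ.≤ n → ℚ.∣ u m n ∣ ℚ.< ε

  Bounded : (ℕ → ℕ → ℚ) → Set
  Bounded u = ∃ λ B → 0ℚ ℚ.< B × ∃ λ N →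
              ∀ m n → N ℕ.≤ m → N ℕ.≤ n → ℚ.∣ u m n ∣ ℚ.≤ B

  small-resp : ∀ {u v} → (∀ m n → u m n ≡ v m n) → Small u → Small v
  small-resp u≡v su ε ε>0 with N , h ← su ε ε>0 =
    N , λ m n p q → ≡.subst (λ t → ℚ.∣ t ∣ ℚ.< ε) (u≡v m n) (h m n p q)

  half+half : ∀ ε → ε ℚ.* ½ ℚ.+ ε ℚ.* ½ ≡ ε
  half+half ε = ≡.trans (≡.sym (ℚ.*-distribˡ-+ ε ½ ½)) (ℚ.*-identityʳ ε)

  half>0 : ∀ ε → 0ℚ ℚ.< ε → 0ℚ ℚ.< ε ℚ.* ½
  half>0 ε ε>0 = ℚ.*-monoˡ-<-pos ½ ε>0

  small-+ : ∀ {u v} → Small u → Small v → Small (λ m n → u m n ℚ.+ v m n)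
  small-+ {u} {v} su sv ε ε>0
    with N , h ← su (ε ℚ.* ½) (half>0 ε ε>0)
       | M , k ← sv (ε ℚ.* ½) (half>0 ε ε>0) =
    N ⊔ M , λ m n p q → begin-strict
      ℚ.∣ u m n ℚ.+ v m n ∣
        ≤⟨ ℚ.∣p+q∣≤∣p∣+∣q∣ (u m n) (v m n) ⟩
      ℚ.∣ u m n ∣ ℚ.+ ℚ.∣ v m n ∣
        <⟨ ℚ.+-mono-< (h m n (ℕ.m⊔n≤o⇒m≤o N M p) (ℕ.m⊔n≤o⇒m≤o N M q))
                      (k m n (ℕ.m⊔n≤o⇒n≤o N M p) (ℕ.m⊔n≤o⇒n≤o N M q)) ⟩
      ε ℚ.* ½ ℚ.+ ε ℚ.* ½
        ≡⟨ half+half ε ⟩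
      ε ∎
    where open ℚ.≤-Reasoning

  small-neg : ∀ {u} → Small u → Small (λ m n → ℚ.- u m n)
  small-neg {u} su ε ε>0 with N , h ← su ε ε>0 =
    N , λ m n p q →
      ≡.subst (ℚ._< ε) (≡.sym (ℚ.∣-p∣≡∣p∣ (u m n))) (h m n p q)

  small-* : ∀ {u v} → Bounded u → Small v → Small (λ m n → u m n ℚ.* v m n)
  small-* {u} {v} (B , B>0 , M , b) sv ε ε>0 =
    let instance
          posB : ℚ.Positive B
          posB = ℚ.positive B>0
          nzB : ℚ.NonZero B
          nzB = ℚ.pos⇒nonZero B
          posε : ℚ.Positive ε
          posε = ℚ.positive ε>0
          pos1/B : ℚ.Positive (ℚ.1/ B)
          pos1/B = ℚ.1/pos⇒pos B
        δ = ε ℚ.* ℚ.1/ B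
        N , h = sv δ (ℚ.positive⁻¹ δ {{ℚ.pos*pos⇒pos ε (ℚ.1/ B)}})
        open ℚ.≤-Reasoning
    in N ⊔ M , λ m n p q → begin-strict
      ℚ.∣ u m n ℚ.* v m n ∣
        ≡⟨ ℚ.∣p*q∣≡∣p∣*∣q∣ (u m n) (v m n) ⟩
      ℚ.∣ u m n ∣ ℚ.* ℚ.∣ v m n ∣
        ≤⟨ ℚ.*-monoʳ-≤-nonNeg ℚ.∣ v m n ∣ {{ℚ.nonNegative (ℚ.0≤∣p∣ (v m n))}}
             (b m n (ℕ.m⊔n≤o⇒n≤o N M p) (ℕ.m⊔n≤o⇒n≤o N M q)) ⟩
      B ℚ.* ℚ.∣ v m n ∣
        <⟨ ℚ.*-monoʳ-<-pos B
             (h m n (ℕ.m⊔n≤o⇒m≤o N M p) (ℕ.m⊔n≤o⇒m≤o N M q)) ⟩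
      B ℚ.* (ε ℚ.* ℚ.1/ B)
        ≡⟨ left-comm B ε (ℚ.1/ B) ⟩
      ε ℚ.* (B ℚ.* ℚ.1/ B)
        ≡⟨ ≡.cong (ε ℚ.*_) (ℚ.*-inverseʳ B) ⟩
      ε ℚ.* 1ℚ
        ≡⟨ ℚ.*-identityʳ ε ⟩
      ε ∎

  0<1 : 0ℚ ℚ.< 1ℚ
  0<1 = ℚ.positive⁻¹ 1ℚ

  bound : ∀ x → ∃ λ B → 0ℚ ℚ.< B × ∃ λ N → ∀ n → N ℕ.≤ n → ℚ.∣ seq x n ∣ ℚ.≤ B
  bound x with N , h ← cauchy x 1ℚ 0<1 =
    1ℚ ℚ.+ ℚ.∣ seq x N ∣ ,
    ℚ.+-mono-<-≤ 0<1 (ℚ.0≤∣p∣ (seq x N)) ,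
    N , λ n p → begin
      ℚ.∣ seq x n ∣
        ≡⟨ ≡.cong ℚ.∣_∣ (split (seq x n) (seq x N)) ⟩
      ℚ.∣ (seq x n ℚ.- seq x N) ℚ.+ seq x N ∣
        ≤⟨ ℚ.∣p+q∣≤∣p∣+∣q∣ (seq x n ℚ.- seq x N) (seq x N) ⟩
      ℚ.∣ seq x n ℚ.- seq x N ∣ ℚ.+ ℚ.∣ seq x N ∣
        ≤⟨ ℚ.+-monoˡ-≤ ℚ.∣ seq x N ∣ (ℚ.<⇒≤ (h n N p ℕ.≤-refl)) ⟩
      1ℚ ℚ.+ ℚ.∣ seq x N ∣ ∎
    where open ℚ.≤-Reasoning

  bounded₁ : ∀ x → Bounded (λ m _ → seq x m)
  bounded₁ x = let B , B>0 , N , h = bound x in B , B>0 , N , λ m _ p _ → h m p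

  bounded₂ : ∀ x → Bounded (λ _ n → seq x n)
  bounded₂ x = let B , B>0 , N , h = bound x in B , B>0 , N , λ _ n _ q → h n q

  fromSmall : ∀ {x y} → Small (λ m _ → seq x m ℚ.- seq y m) → x ≈ℝ y
  fromSmall s ε ε>0 = let N , h = s ε ε>0 in N , λ n p → h n n p p

  toSmall : ∀ {x y} → x ≈ℝ y → Small (λ m _ → seq x m ℚ.- seq y m)
  toSmall e ε ε>0 = let N , h = e ε ε>0 in N , λ m _ p _ → h m p

  pointwise : ∀ {x y} → (∀ n → seq x n ≡ seq y n) → x ≈ℝ y
  pointwise {x} {y} x≡y ε ε>0 = 0 , λ n _ →
    ≡.subst (λ t → ℚ.∣ t ∣ ℚ.< ε)
      (≡.sym (≡.trans (≡.cong (ℚ._- seq y n) (x≡y n)) (ℚ.+-inverseʳ (seq y n)))) ε>0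

  ≈-isEquivalence : IsEquivalence _≈ℝ_
  ≈-isEquivalence = record
    { refl  = λ {x} → pointwise {x} {x} (λ _ → refl)
    ; sym   = λ {x} {y} e → fromSmall {y} {x}
        (small-resp (λ m _ → opp (seq x m) (seq y m))
          (small-neg {λ m _ → seq x m ℚ.- seq y m} (toSmall {x} {y} e)))
    ; trans = λ {x} {y} {z} e f → fromSmall {x} {z}
        (small-resp (λ m _ → telescope (seq x m) (seq y m) (seq z m))
          (small-+ {λ m _ → seq x m ℚ.- seq y m} {λ m _ → seq y m ℚ.- seq z m}
            (toSmall {x} {y} e) (toSmall {y} {z} f)))
    }

  fromℚ : ℚ → ℝ
  fromℚ q = record
    { seq    = λ _ → q
    ; cauchy = λ ε ε>0 → 0 , λ _ _ _ _ →
        ≡.subst (λ t → ℚ.∣ t ∣ ℚ.< ε) (≡.sym (ℚ.+-inverseʳ q)) ε>0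
    }

  infixl 6 _+_
  infixl 7 _*_
  infix  8 -_

  _+_ : ℝ → ℝ → ℝ
  x + y = record
    { seq    = λ n → seq x n ℚ.+ seq y n
    ; cauchy = small-resp
        (λ m n → add-sub (seq x m) (seq x n) (seq y m) (seq y n))
        (small-+ {λ m n → seq x m ℚ.- seq x n} {λ m n → seq y m ℚ.- seq y n}
          (cauchy x) (cauchy y))
    }

  -_ : ℝ → ℝ
  - x = record
    { seq    = λ n → ℚ.- seq x n
    ; cauchy = small-resp (λ m n → neg-sub (seq x m) (seq x n))
        (small-neg {λ m n → seq x m ℚ.- seq x n} (cauchy x))
    }

  _*_ : ℝ → ℝ → ℝ
  x * y = record
    { seq    = λ n → seq x n ℚ.* seq y n
    ; cauchy = small-resp
        (λ m n → mul-sub (seq x m) (seq x n) (seq y m) (seq y n))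
        (small-+ {λ m n → seq x m ℚ.* (seq y m ℚ.- seq y n)}
                 {λ m n → seq y n ℚ.* (seq x m ℚ.- seq x n)}
          (small-* {λ m n → seq x m} {λ m n → seq y m ℚ.- seq y n} (bounded₁ x) (cauchy y))
          (small-* {λ m n → seq y n} {λ m n → seq x m ℚ.- seq x n} (bounded₂ y) (cauchy x)))
    }

  +-cong : ∀ {x y u v} → x ≈ℝ y → u ≈ℝ v → x + u ≈ℝ y + v
  +-cong {x} {y} {u} {v} e f = fromSmall {x + u} {y + v} (small-resp
    (λ m _ → add-sub (seq x m) (seq y m) (seq u m) (seq v m))
    (small-+ {λ m _ → seq x m ℚ.- seq y m} {λ m _ → seq u m ℚ.- seq v m}
      (toSmall {x} {y} e) (toSmall {u} {v} f)))

  neg-cong : ∀ {x y} → x ≈ℝ y → - x ≈ℝ - y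
  neg-cong {x} {y} e = fromSmall { - x} { - y} (small-resp
    (λ m _ → neg-sub (seq x m) (seq y m))
    (small-neg {λ m _ → seq x m ℚ.- seq y m} (toSmall {x} {y} e)))

  *-cong : ∀ {x y u v} → x ≈ℝ y → u ≈ℝ v → x * u ≈ℝ y * v
  *-cong {x} {y} {u} {v} e f = fromSmall {x * u} {y * v} (small-resp
    (λ m _ → mul-sub (seq x m) (seq y m) (seq u m) (seq v m))
    (small-+ {λ m _ → seq x m ℚ.* (seq u m ℚ.- seq v m)}
             {λ m _ → seq v m ℚ.* (seq x m ℚ.- seq y m)}
      (small-* {λ m _ → seq x m} {λ m _ → seq u m ℚ.- seq v m} (bounded₁ x) (toSmall {u} {v} f))
      (small-* {λ m _ → seq v m} {λ m _ → seq x m ℚ.- seq y m} (bounded₁ v) (toSmall {x} {y} e))))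

ℝ-commutativeRing : CommutativeRing 0ℓ 0ℓ
ℝ-commutativeRing = record
  { Carrier = ℝ
  ; _≈_     = _≈ℝ_
  ; _+_     = _+_
  ; _*_     = _*_
  ; -_      = -_
  ; 0#      = fromℚ 0ℚ
  ; 1#      = fromℚ 1ℚ
  ; isCommutativeRing = record
    { isRing = record
      { +-isAbelianGroup = record
        { isGroup = record
          { isMonoid = record
            { isSemigroup = record
              { isMagma = record
                { isEquivalence = ≈-isEquivalence
                ; ∙-cong = λ {x} {y} {u} {v} → +-cong {x} {y} {u} {v}
                }
              ; assoc = λ x y z → pointwise {(x + y) + z} {x + (y + z)}
                  λ n → ℚ.+-assoc (seq x n) (seq y n) (seq z n)
              }
            ; identity =
                (λ x → pointwise {fromℚ 0ℚ + x} {x} λ n → ℚ.+-identityˡ (seq x n)) ,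
                (λ x → pointwise {x + fromℚ 0ℚ} {x} λ n → ℚ.+-identityʳ (seq x n))
            }
          ; inverse =
              (λ x → pointwise { - x + x} {fromℚ 0ℚ} λ n → ℚ.+-inverseˡ (seq x n)) ,
              (λ x → pointwise {x + - x} {fromℚ 0ℚ} λ n → ℚ.+-inverseʳ (seq x n))
          ; ⁻¹-cong = λ {x} {y} → neg-cong {x} {y}
          }
        ; comm = λ x y → pointwise {x + y} {y + x} λ n → ℚ.+-comm (seq x n) (seq y n)
        }
      ; *-cong = λ {x} {y} {u} {v} → *-cong {x} {y} {u} {v}
      ; *-assoc = λ x y z → pointwise {(x * y) * z} {x * (y * z)}
          λ n → ℚ.*-assoc (seq x n) (seq y n) (seq z n)
      ; *-identity =
          (λ x → pointwise {fromℚ 1ℚ * x} {x} λ n → ℚ.*-identityˡ (seq x n)) ,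
          (λ x → pointwise {x * fromℚ 1ℚ} {x} λ n → ℚ.*-identityʳ (seq x n))
      ; distrib =
          (λ x y z → pointwise {x * (y + z)} {x * y + x * z}
             λ n → ℚ.*-distribˡ-+ (seq x n) (seq y n) (seq z n)) ,
          (λ x y z → pointwise {(y + z) * x} {y * x + z * x}
             λ n → ℚ.*-distribʳ-+ (seq x n) (seq y n) (seq z n))
      }
    ; *-comm = λ x y → pointwise {x * y} {y * x} λ n → ℚ.*-comm (seq x n) (seq y n)
    }
  }
  where open RealArithmetic

module _ {r ℓr m ℓm} {R : CommutativeRing r ℓr} (M : Module R m ℓm) where

  private module R = CommutativeRing R
  open Module M
  open MonoidSum +ᴹ-commutativeMonoid using (sum)

  linearCombination : ∀ {n} → Vector R.Carrier n → Vector Carrierᴹ n → Carrierᴹ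
  linearCombination c x = sum λ j → c j *ₗ x j

  -- The index set I is arbitrary, possibly infinite.  As equality on I need
  -- not be decidable, finite subfamilies are given by injections Fin n → I.
  record IsBasis {i} {I : Set i} (b : I → Carrierᴹ) : Set (i ⊔ˡ r ⊔ˡ ℓr ⊔ˡ m ⊔ˡ ℓm) where
    field
      spanning    : ∀ x → ∃ λ n → Σ (Vector I n) λ k → Σ (Vector R.Carrier n) λ c →
                    linearCombination c (b ∘ k) ≈ᴹ x
      independent : ∀ {n} (k : Vector I n) → Injective _≡_ _≡_ k →
                    ∀ c → linearCombination c (b ∘ k) ≈ᴹ 0ᴹ → ∀ j → c j R.≈ R.0#

------------------------------------------------------------------------
-- Multi-indices α ∈ ℕˡ with |α| = m

MultiIndex : ℕ → ℕ → Set
MultiIndex ℓ m = Σ (Vec ℕ ℓ) λ α → Vec.sum α ≡ m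

module _ {ℓ m : ℕ} where

  zero∷_ : MultiIndex ℓ m → MultiIndex (suc ℓ) m
  zero∷ (α , p) = 0 ∷ α , p

  sucHead : MultiIndex (suc ℓ) m → MultiIndex (suc ℓ) (suc m)
  sucHead (k ∷ α , p) = suc k ∷ α , ≡.cong suc p

multiIndices : ∀ ℓ m → List (MultiIndex ℓ m)
multiIndices zero    zero    = ([] , refl) ∷ []
multiIndices zero    (suc m) = []
multiIndices (suc ℓ) zero    = List.map zero∷_ (multiIndices ℓ zero)
multiIndices (suc ℓ) (suc m) =
  List.map zero∷_ (multiIndices ℓ (suc m)) ++ List.map sucHead (multiIndices (suc ℓ) m)

multiIndices-complete : ∀ {ℓ m} (α : MultiIndex ℓ m) → α ∈ multiIndices ℓ m
multiIndices-complete {zero}  {zero}  ([] , refl) = here refl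
multiIndices-complete {suc ℓ} {zero}  (zero ∷ α , p) =
  ∈-map⁺ zero∷_ (multiIndices-complete (α , p))
multiIndices-complete {suc ℓ} {suc m} (zero ∷ α , p) =
  ∈-++⁺ˡ (∈-map⁺ zero∷_ (multiIndices-complete (α , p)))
multiIndices-complete {suc ℓ} {suc m} (suc k ∷ α , refl) =
  ∈-++⁺ʳ (List.map zero∷_ (multiIndices ℓ (suc m)))
    (∈-map⁺ sucHead (multiIndices-complete (k ∷ α , refl)))

multiIndices-unique : ∀ ℓ m → Unique (multiIndices ℓ m)
multiIndices-unique zero    zero    = [] ∷ []
multiIndices-unique zero    (suc m) = []
multiIndices-unique (suc ℓ) zero    =
  Unique.map⁺ (λ { refl → refl }) (multiIndices-unique ℓ zero)
multiIndices-unique (suc ℓ) (suc m) = Unique.++⁺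
  (Unique.map⁺ (λ { refl → refl }) (multiIndices-unique ℓ (suc m)))
  (Unique.map⁺ sucHead-injective (multiIndices-unique (suc ℓ) m))
  λ (p , q) → disjoint (∈-map⁻ zero∷_ p) (∈-map⁻ sucHead q)
  where
  sucHead-injective : ∀ {α β : MultiIndex (suc ℓ) m} → sucHead α ≡ sucHead β → α ≡ β
  sucHead-injective {k ∷ α , p} {k′ ∷ α′ , q} eq with refl ← ≡.cong proj₁ eq =
    ≡.cong (k ∷ α ,_) (ℕ.≡-irrelevant p q)

  disjoint : ∀ {γ : MultiIndex (suc ℓ) (suc m)} →
             (∃ λ α → α ∈ multiIndices ℓ (suc m) × γ ≡ zero∷ α) →
             (∃ λ β → β ∈ multiIndices (suc ℓ) m × γ ≡ sucHead β) → Empty.⊥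
  disjoint (_ , _ , refl) ((_ ∷ _ , _) , _ , ())

------------------------------------------------------------------------
-- Signed permutations: w sends eᵢ to ± e_{σ(i)}, the sign being − when
-- σ(i) belongs to the set of flipped coordinates.

record SignedPermutation (ℓ : ℕ) : Set where
  constructor _◂_
  field
    flips : Subset ℓ
    perm  : Permutation′ ℓ

open SignedPermutation public

infix 9 _⁻¹

_⁻¹ : ∀ {ℓ} → SignedPermutation ℓ → SignedPermutation ℓ
w ⁻¹ = tabulate (λ i → lookup (flips w) (perm w ⟨$⟩ʳ i)) ◂ Perm.flip (perm w)

module CoordinateAction {r ℓr} (R : CommutativeRing r ℓr) where

  open CommutativeRing R renaming (refl to ≈-refl)

  act : ∀ {ℓ} → SignedPermutation ℓ → Vector Carrier ℓ → Vector Carrier ℓ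
  act w v i = if lookup (flips w) i then - v (perm w ⟨$⟩ˡ i) else v (perm w ⟨$⟩ˡ i)

  act-⁻¹ : ∀ {ℓ} (w : SignedPermutation ℓ) v i → act w (act (w ⁻¹) v) i ≈ v i
  act-⁻¹ w v i
    rewrite lookup∘tabulate (λ j → lookup (flips w) (perm w ⟨$⟩ʳ j)) (perm w ⟨$⟩ˡ i)
          | inverseʳ (perm w) {i}
    with lookup (flips w) i
  ... | true  = RingProperties.-‿involutive ring (v i)
  ... | false = ≈-refl

data ReflectionType : Set where
  A B D : ReflectionType

infix 4 _∈W_

_∈W_ : ∀ {ℓ} → SignedPermutation ℓ → ReflectionType → Set
w ∈W A = flips w ≡ ⊥
w ∈W B = ⊤
w ∈W D = 2 ∣ ∣ flips w ∣

minRank : ReflectionType → ℕ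
minRank A = 2
minRank B = 2
minRank D = 4

------------------------------------------------------------------------
-- The polynomial ring K[x₁,…,xₗ], presented as the free commutative
-- K-algebra on ℓ generators.

module Polynomials {c e} (K : CommutativeRing c e) (ℓ : ℕ) where

  private module K = CommutativeRing K

  infixl 6 _:+_
  infixl 7 _:*_
  infix  8 :-_
  infix  4 _≋_

  data Poly : Set c where
    con       : K.Carrier → Poly
    var       : Fin ℓ → Poly
    _:+_ _:*_ : Poly → Poly → Poly
    :-_       : Poly → Poly

  data _≋_ : Poly → Poly → Set (c ⊔ˡ e) where
    refl       : ∀ {f} → f ≋ f
    sym        : ∀ {f g} → f ≋ g → g ≋ f
    trans      : ∀ {f g h} → f ≋ g → g ≋ h → f ≋ h
    +-cong     : ∀ {f g h k} → f ≋ g → h ≋ k → f :+ h ≋ g :+ k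
    *-cong     : ∀ {f g h k} → f ≋ g → h ≋ k → f :* h ≋ g :* k
    -‿cong     : ∀ {f g} → f ≋ g → :- f ≋ :- g
    +-assoc    : ∀ f g h → (f :+ g) :+ h ≋ f :+ (g :+ h)
    +-comm     : ∀ f g → f :+ g ≋ g :+ f
    +-identity : ∀ f → con K.0# :+ f ≋ f
    +-inverse  : ∀ f → (:- f) :+ f ≋ con K.0#
    *-assoc    : ∀ f g h → (f :* g) :* h ≋ f :* (g :* h)
    *-comm     : ∀ f g → f :* g ≋ g :* f
    *-identity : ∀ f → con K.1# :* f ≋ f
    *-distrib  : ∀ f g h → f :* (g :+ h) ≋ f :* g :+ f :* h
    con-cong   : ∀ {a b} → a K.≈ b → con a ≋ con b
    con-+      : ∀ a b → con (a K.+ b) ≋ con a :+ con b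
    con-*      : ∀ a b → con (a K.* b) ≋ con a :* con b

  S : CommutativeRing c (c ⊔ˡ e)
  S = record
    { Carrier = Poly
    ; _≈_     = _≋_
    ; _+_     = _:+_
    ; _*_     = _:*_
    ; -_      = :-_
    ; 0#      = con K.0#
    ; 1#      = con K.1#
    ; isCommutativeRing = record
      { isRing = record
        { +-isAbelianGroup = record
          { isGroup = record
            { isMonoid = record
              { isSemigroup = record
                { isMagma = record
                  { isEquivalence = record { refl = refl ; sym = sym ; trans = trans }
                  ; ∙-cong = +-cong
                  }
                ; assoc = +-assoc
                }
              ; identity = +-identity , λ f → trans (+-comm _ _) (+-identity f)
              }
            ; inverse = +-inverse , λ f → trans (+-comm _ _) (+-inverse f)
            ; ⁻¹-cong = -‿cong
            }
          ; comm = +-comm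
          }
        ; *-cong     = *-cong
        ; *-assoc    = *-assoc
        ; *-identity = *-identity , λ f → trans (*-comm _ _) (*-identity f)
        ; distrib    = *-distrib , λ f g h →
            trans (*-comm _ _) (trans (*-distrib f g h) (+-cong (*-comm _ _) (*-comm _ _)))
        }
      ; *-comm = *-comm
      }
    }

  private
    module S = CommutativeRing S
    module SP = RingProperties S.ring

  open MonoidSum S.*-commutativeMonoid public using () renaming (sum to product)

  eval : Vector K.Carrier ℓ → Poly → K.Carrier
  eval v (con a)  = a
  eval v (var i)  = v i
  eval v (f :+ g) = eval v f K.+ eval v g
  eval v (f :* g) = eval v f K.* eval v g
  eval v (:- f)   = K.- eval v f

  eval-cong : ∀ v {f g} → f ≋ g → eval v f K.≈ eval v g
  eval-cong v refl              = K.refl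
  eval-cong v (sym p)           = K.sym (eval-cong v p)
  eval-cong v (trans p q)       = K.trans (eval-cong v p) (eval-cong v q)
  eval-cong v (+-cong p q)      = K.+-cong (eval-cong v p) (eval-cong v q)
  eval-cong v (*-cong p q)      = K.*-cong (eval-cong v p) (eval-cong v q)
  eval-cong v (-‿cong p)        = K.-‿cong (eval-cong v p)
  eval-cong v (+-assoc f g h)   = K.+-assoc _ _ _
  eval-cong v (+-comm f g)      = K.+-comm _ _
  eval-cong v (+-identity f)    = K.+-identityˡ _
  eval-cong v (+-inverse f)     = K.-‿inverseˡ _
  eval-cong v (*-assoc f g h)   = K.*-assoc _ _ _
  eval-cong v (*-comm f g)      = K.*-comm _ _
  eval-cong v (*-identity f)    = K.*-identityˡ _
  eval-cong v (*-distrib f g h) = K.distribˡ _ _ _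
  eval-cong v (con-cong p)      = p
  eval-cong v (con-+ a b)       = K.refl
  eval-cong v (con-* a b)       = K.refl

  substitute : Vector Poly ℓ → Poly → Poly
  substitute ρ (con a)  = con a
  substitute ρ (var i)  = ρ i
  substitute ρ (f :+ g) = substitute ρ f :+ substitute ρ g
  substitute ρ (f :* g) = substitute ρ f :* substitute ρ g
  substitute ρ (:- f)   = :- substitute ρ f

  substitute-cong : ∀ ρ {f g} → f ≋ g → substitute ρ f ≋ substitute ρ g
  substitute-cong ρ refl              = refl
  substitute-cong ρ (sym p)           = sym (substitute-cong ρ p)
  substitute-cong ρ (trans p q)       = trans (substitute-cong ρ p) (substitute-cong ρ q)
  substitute-cong ρ (+-cong p q)      = +-cong (substitute-cong ρ p) (substitute-cong ρ q)
  substitute-cong ρ (*-cong p q)      = *-cong (substitute-cong ρ p) (substitute-cong ρ q)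
  substitute-cong ρ (-‿cong p)        = -‿cong (substitute-cong ρ p)
  substitute-cong ρ (+-assoc f g h)   = +-assoc _ _ _
  substitute-cong ρ (+-comm f g)      = +-comm _ _
  substitute-cong ρ (+-identity f)    = +-identity _
  substitute-cong ρ (+-inverse f)     = +-inverse _
  substitute-cong ρ (*-assoc f g h)   = *-assoc _ _ _
  substitute-cong ρ (*-comm f g)      = *-comm _ _
  substitute-cong ρ (*-identity f)    = *-identity _
  substitute-cong ρ (*-distrib f g h) = *-distrib _ _ _
  substitute-cong ρ (con-cong p)      = con-cong p
  substitute-cong ρ (con-+ a b)       = con-+ a b
  substitute-cong ρ (con-* a b)       = con-* a b

  ∂ : Fin ℓ → Poly → Poly
  ∂ i (con a)  = S.0#
  ∂ i (var j)  = if does (i ≟ j) then S.1# else S.0#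
  ∂ i (f :+ g) = ∂ i f :+ ∂ i g
  ∂ i (f :* g) = ∂ i f :* g :+ f :* ∂ i g
  ∂ i (:- f)   = :- ∂ i f

  private
    open SemiringSolver S.commutativeSemiring
      using (solve; _:=_) renaming (_:+_ to _⊕_; _:*_ to _⊗_)

    *-zeroˡ-+ : ∀ f g → S.0# :* f :+ g ≋ g
    *-zeroˡ-+ f g = trans (+-cong (S.zeroˡ f) refl) (+-identity g)

  ∂-cong : ∀ i {f g} → f ≋ g → ∂ i f ≋ ∂ i g
  ∂-cong i refl            = refl
  ∂-cong i (sym p)         = sym (∂-cong i p)
  ∂-cong i (trans p q)     = trans (∂-cong i p) (∂-cong i q)
  ∂-cong i (+-cong p q)    = +-cong (∂-cong i p) (∂-cong i q)
  ∂-cong i (*-cong p q)    = +-cong (*-cong (∂-cong i p) q) (*-cong p (∂-cong i q))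
  ∂-cong i (-‿cong p)      = -‿cong (∂-cong i p)
  ∂-cong i (+-assoc f g h) = +-assoc _ _ _
  ∂-cong i (+-comm f g)    = +-comm _ _
  ∂-cong i (+-identity f)  = +-identity _
  ∂-cong i (+-inverse f)   = +-inverse _
  ∂-cong i (*-assoc f g h) =
    solve 6 (λ f g h f′ g′ h′ →
      (f′ ⊗ g ⊕ f ⊗ g′) ⊗ h ⊕ (f ⊗ g) ⊗ h′ := f′ ⊗ (g ⊗ h) ⊕ f ⊗ (g′ ⊗ h ⊕ g ⊗ h′))
      refl f g h (∂ i f) (∂ i g) (∂ i h)
  ∂-cong i (*-comm f g)    =
    trans (+-comm _ _) (+-cong (*-comm _ _) (*-comm _ _))
  ∂-cong i (*-identity f)  = trans (*-zeroˡ-+ _ _) (*-identity _)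
  ∂-cong i (*-distrib f g h) =
    solve 6 (λ f g h f′ g′ h′ →
      f′ ⊗ (g ⊕ h) ⊕ f ⊗ (g′ ⊕ h′) := (f′ ⊗ g ⊕ f ⊗ g′) ⊕ (f′ ⊗ h ⊕ f ⊗ h′))
      refl f g h (∂ i f) (∂ i g) (∂ i h)
  ∂-cong i (con-cong p)    = refl
  ∂-cong i (con-+ a b)     = sym (+-identity _)
  ∂-cong i (con-* a b)     = sym (trans (*-zeroˡ-+ _ _) (S.zeroʳ _))

  ∂^ : Vec ℕ ℓ → Poly → Poly
  ∂^ α f = List.foldr (λ i g → fold g (∂ i) (lookup α i)) f (allFin ℓ)

  ----------------------------------------------------------------------
  -- D⁽ᵐ⁾(S): the family of coefficients θ stands for Σ_{|α|=m} θ_α ∂^α.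

  DiffOp : ℕ → Set c
  DiffOp m = MultiIndex ℓ m → Poly

  weightedSum : ∀ {a} {X : Set a} → (X → Poly) → (X → Poly) → List X → Poly
  weightedSum f h = List.foldr (λ x s → f x :* h x :+ s) S.0#

  apply : ∀ {m} → DiffOp m → Poly → Poly
  apply {m} θ f = weightedSum θ (λ α → ∂^ (proj₁ α) f) (multiIndices ℓ m)

  module _ {a} {X : Set a} where

    weightedSum-0 : ∀ (h : X → Poly) xs → weightedSum (λ _ → S.0#) h xs ≋ S.0#
    weightedSum-0 h []       = refl
    weightedSum-0 h (x ∷ xs) = trans (*-zeroˡ-+ _ _) (weightedSum-0 h xs)

    weightedSum-+ : ∀ (f g h : X → Poly) xs →
      weightedSum (λ x → f x :+ g x) h xs ≋ weightedSum f h xs :+ weightedSum g h xs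
    weightedSum-+ f g h []       = sym (+-identity _)
    weightedSum-+ f g h (x ∷ xs) = trans (+-cong refl (weightedSum-+ f g h xs))
      (solve 5 (λ a b c s t → (a ⊕ b) ⊗ c ⊕ (s ⊕ t) := (a ⊗ c ⊕ s) ⊕ (b ⊗ c ⊕ t)) refl
        (f x) (g x) (h x) (weightedSum f h xs) (weightedSum g h xs))

    weightedSum-neg : ∀ (f h : X → Poly) xs →
      weightedSum (λ x → :- f x) h xs ≋ :- weightedSum f h xs
    weightedSum-neg f h []       = sym SP.-0#≈0#
    weightedSum-neg f h (x ∷ xs) = trans
      (+-cong (sym (SP.-‿distribˡ-* (f x) (h x))) (weightedSum-neg f h xs))
      (SP.-‿+-comm _ _)

    weightedSum-* : ∀ p (f h : X → Poly) xs →
      weightedSum (λ x → p :* f x) h xs ≋ p :* weightedSum f h xs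
    weightedSum-* p f h []       = sym (S.zeroʳ p)
    weightedSum-* p f h (x ∷ xs) =
      trans (+-cong (*-assoc _ _ _) (weightedSum-* p f h xs)) (sym (*-distrib _ _ _))

  open Divisibility S.semiring public using () renaming (_∣_ to _∣ₛ_; _,_ to _,∣_)

  -- θ(QS) ⊆ QS
  Stabilises : ∀ {m} → Poly → DiffOp m → Set (c ⊔ˡ e)
  Stabilises Q θ = ∀ f → Q ∣ₛ f → Q ∣ₛ apply θ f

  -- D⁽ᵐ⁾(𝒜) for the arrangement 𝒜 with defining polynomial Q.
  D⁽_⁾ : (m : ℕ) → Poly → Module S (c ⊔ˡ e) (c ⊔ˡ e)
  D⁽ m ⁾ Q = record
    { Carrierᴹ = M
    ; _≈ᴹ_     = _≈_
    ; _+ᴹ_     = _+_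
    ; _*ₗ_     = _*_
    ; _*ᵣ_     = flip _*_
    ; 0ᴹ       = 0ᴹ
    ; -ᴹ_      = -_
    ; isModule = IsModuleFromLeft.isModule {commutativeRing = S} record { isLeftModule = isLeftModule }
    }
    where
    M : Set (c ⊔ˡ e)
    M = Σ (DiffOp m) (Stabilises Q)

    _≈_ : M → M → Set (c ⊔ˡ e)
    (θ , _) ≈ (η , _) = ∀ α → θ α ≋ η α

    ≈-isEquivalence : IsEquivalence _≈_
    ≈-isEquivalence = record
      { refl  = λ α → refl
      ; sym   = λ p α → sym (p α)
      ; trans = λ p q α → trans (p α) (q α)
      }

    _+_ : M → M → M
    (θ , p) + (η , q) = (λ α → θ α :+ η α) , λ f Q∣f →
      let (a ,∣ aQ≋θf) = p f Q∣f
          (b ,∣ bQ≋ηf) = q f Q∣f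
      in a :+ b ,∣ trans (S.distribʳ _ _ _) (trans (+-cong aQ≋θf bQ≋ηf)
                    (sym (weightedSum-+ θ η _ (multiIndices ℓ m))))

    0ᴹ : M
    0ᴹ = (λ α → S.0#) , λ f Q∣f →
      S.0# ,∣ trans (S.zeroˡ _) (sym (weightedSum-0 _ (multiIndices ℓ m)))

    -_ : M → M
    - (θ , p) = (λ α → :- θ α) , λ f Q∣f →
      let (a ,∣ aQ≋θf) = p f Q∣f
      in :- a ,∣ trans (sym (SP.-‿distribˡ-* _ _)) (trans (-‿cong aQ≋θf)
                  (sym (weightedSum-neg θ _ (multiIndices ℓ m))))

    _*_ : Poly → M → M
    g * (θ , p) = (λ α → g :* θ α) , λ f Q∣f →
      let (a ,∣ aQ≋θf) = p f Q∣f
      in g :* a ,∣ trans (*-assoc _ _ _) (trans (*-cong refl aQ≋θf)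
                    (sym (weightedSum-* g θ _ (multiIndices ℓ m))))

    isLeftModule : IsLeftModule S.ring _≈_ _+_ 0ᴹ -_ _*_
    isLeftModule = record
      { isLeftSemimodule = record
        { +ᴹ-isCommutativeMonoid = record
          { isMonoid = record
            { isSemigroup = record
              { isMagma = record
                { isEquivalence = ≈-isEquivalence
                ; ∙-cong = λ p q α → +-cong (p α) (q α)
                }
              ; assoc = λ _ _ _ α → +-assoc _ _ _
              }
            ; identity = (λ _ α → S.+-identityˡ _) , (λ _ α → S.+-identityʳ _)
            }
          ; comm = λ _ _ α → +-comm _ _
          }
        ; isPreleftSemimodule = record
          { *ₗ-cong      = λ p q α → *-cong p (q α)
          ; *ₗ-zeroˡ     = λ _ α → S.zeroˡ _
          ; *ₗ-distribʳ  = λ _ _ _ α → S.distribʳ _ _ _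
          ; *ₗ-identityˡ = λ _ α → S.*-identityˡ _
          ; *ₗ-assoc     = λ _ _ _ α → *-assoc _ _ _
          ; *ₗ-zeroʳ     = λ _ α → S.zeroʳ _
          ; *ₗ-distribˡ  = λ _ _ _ α → *-distrib _ _ _
          }
        }
      ; -ᴹ‿cong    = λ p α → -‿cong (p α)
      ; -ᴹ‿inverse = (λ _ α → S.-‿inverseˡ _) , (λ _ α → S.-‿inverseʳ _)
      }

  open CoordinateAction

  infixr 7 _·_

  -- (w · f)(x) = f(w⁻¹x)
  _·_ : SignedPermutation ℓ → Poly → Poly
  w · f = substitute (act S (w ⁻¹) var) f

  eval-· : ∀ w f v → eval v (w · f) K.≈ eval (act K (w ⁻¹) v) f
  eval-· w (con a)  v = K.refl
  eval-· w (var i)  v with lookup (flips (w ⁻¹)) i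
  ... | true  = K.refl
  ... | false = K.refl
  eval-· w (f :+ g) v = K.+-cong (eval-· w f v) (eval-· w g v)
  eval-· w (f :* g) v = K.*-cong (eval-· w f v) (eval-· w g v)
  eval-· w (:- f)   v = K.-‿cong (eval-· w f v)

  -- w·θ = θ as operators on S for every w in the group, where
  -- (w·θ)(f) = w·(θ(w⁻¹·f)).
  Invariant : ∀ {m} → ReflectionType → DiffOp m → Set (c ⊔ˡ e)
  Invariant T θ = ∀ w → w ∈W T → ∀ f → w · apply θ (w ⁻¹ · f) ≋ apply θ f

  ∏[i<j] : (Fin ℓ → Fin ℓ → Poly) → Poly
  ∏[i<j] g = product λ i → product λ j → if does (i <? j) then g i j else S.1#

  Q : ReflectionType → Poly
  Q A = ∏[i<j] λ i j → var i S.- var j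
  Q B = product var :* ∏[i<j] λ i j → var i :* var i S.- var j :* var j
  Q D = ∏[i<j] λ i j → var i :* var i S.- var j :* var j

module RealPolynomials = Polynomials ℝ-commutativeRing

-- Let α = x₀ − x₁ and let s ∈ W swap the first two coordinates, so that
-- Q = α Q′ with Q′ ≠ 0 at the point v = (1, 1, 2, 3, …) of the mirror of s.
-- For θ ∈ D⁽²⁾(𝒜), modulo the ideal of v, θ(α² Q′) is θ(α²) Q′; it lies in QS
-- since α² Q′ = α Q, hence θ(α²) vanishes at v.  If θ is s-invariant, so is
-- θ(α²), and therefore its derivatives along x₀ and x₁ agree at v.  Both
-- properties persist under S-linear combinations, but they fail for Q ∂₀²,
-- which sends α² to 2 α Q′: the derivatives of 2 α Q′ at v are 2 Q′(v) and
-- − 2 Q′(v).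

module Submission where

open import Defs
open import Algebra.Bundles using (CommutativeRing)
open import Algebra.Module.Bundles using (Module)
import Algebra.Properties.Ring as RingProperties
import Algebra.Properties.Semiring.Mult as Mult
import Algebra.Solver.Ring.NaturalCoefficients.Default as SemiringSolver
open import Data.Bool.Base using (if_then_else_; false)
open import Data.Fin.Base using (Fin; zero; suc; toℕ)
open import Data.Fin.Patterns using (0F; 1F)
open import Data.Fin.Permutation using (transpose; _⟨$⟩ʳ_)
open import Data.Fin.Properties using (_<?_)
open import Data.Fin.Subset using (⊥)
open import Data.Fin.Subset.Properties using (∣⊥∣≡0)
open import Data.List.Base as List using (List; []; _∷_; allFin; foldr; replicate)
open import Data.List.Membership.Propositional using (_∈_)
open import Data.List.Properties using (foldr-++; length-++; length-replicate; map-tabulate)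
open import Data.List.Relation.Unary.All as All using (All; []; _∷_)
import Data.List.Relation.Unary.All.Properties as All
open import Data.List.Relation.Unary.AllPairs using (_∷_)
open import Data.List.Relation.Unary.Any using (here; there)
open import Data.List.Relation.Unary.Unique.Propositional using (Unique)
open import Data.Nat.Base as ℕ using (ℕ; zero; suc; _≤_; _<_; s≤s; z≤n)
open import Data.Nat.Divisibility using (_∣_; _∣0)
open import Data.Nat.GeneralisedArithmetic using (fold)
import Data.Nat.ListAction as ListAction
import Data.Nat.Properties as ℕ
open import Data.Product.Base using (Σ; ∃; _×_; _,_; proj₁; proj₂)
open import Data.Rational.Base as ℚ using (0ℚ; 1ℚ)
import Data.Rational.Properties as ℚ
open import Data.Unit.Base using (tt)
open import Data.Vec.Base as Vec using (Vec; []; _∷_; lookup)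
open import Data.Vec.Functional using (Vector)
open import Data.Vec.Properties using (lookup∘tabulate; lookup-replicate; ≡-dec)
open import Function.Base using (_∘_; id)
open import Relation.Binary.PropositionalEquality as ≡ using (_≡_; _≢_)
open import Relation.Nullary.Decidable using (Dec; does; yes; no)
open import Relation.Nullary.Negation.Core using (¬_; contradiction)
import Relation.Binary.Reasoning.Setoid as SetoidReasoning

-- Regular elements of a commutative ring.

module CommutativeRingLemmas {c e} (R : CommutativeRing c e) where

  open CommutativeRing R
  open Mult semiring using (×-homo-+; ×-congˡ) renaming (_×_ to _·ℕ_)
  open RingProperties ring using (-‿+-comm; -‿distribˡ-*; -‿involutive; -0#≈0#)
  open SetoidReasoning setoid

  difference-of-squares : ∀ x y → x * x - y * y ≈ (x - y) * (x + y)
  difference-of-squares x y = sym (begin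
    (x - y) * (x + y)                ≈⟨ expand x y (- y) ⟩
    x * x + - y * y + x * (- y + y)  ≈⟨ +-cong (+-congˡ (sym (-‿distribˡ-* y y)))
                                                (trans (*-congˡ (-‿inverseˡ y)) (zeroʳ x)) ⟩
    x * x - y * y + 0#               ≈⟨ +-identityʳ _ ⟩
    x * x - y * y                    ∎)
    where
    -- The semiring solver has no negation, so -y is generalised to z; at z = -y the last term
    -- vanishes.
    expand : ∀ x y z → (x + z) * (x + y) ≈ x * x + z * y + x * (z + y)
    expand = let open SemiringSolver commutativeSemiring in
      solve 3 (λ x y z → (x :+ z) :* (x :+ y) := x :* x :+ z :* y :+ x :* (z :+ y)) refl

  -- Plays the part of "nonzero": cancellability passes to products over any commutative ring and
  -- asks neither for inverses nor for decidable equality.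
  Regular : Carrier → Set _
  Regular a = ∀ x → a * x ≈ 0# → x ≈ 0#

  regular-resp-≈ : ∀ {a b} → a ≈ b → Regular a → Regular b
  regular-resp-≈ a≈b reg x bx≈0 = reg x (trans (*-congʳ a≈b) bx≈0)

  regular-1 : Regular 1#
  regular-1 x 1x≈0 = trans (sym (*-identityˡ x)) 1x≈0

  regular-* : ∀ {a b} → Regular a → Regular b → Regular (a * b)
  regular-* {a} {b} rega regb x abx≈0 =
    regb x (rega (b * x) (trans (sym (*-assoc a b x)) abx≈0))

  regular-neg : ∀ {a} → Regular a → Regular (- a)
  regular-neg {a} reg x -ax≈0 = reg x (begin
    a * x          ≈⟨ -‿involutive (a * x) ⟨
    - - (a * x)    ≈⟨ -‿cong (trans (-‿distribˡ-* a x) -ax≈0) ⟩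
    - 0#           ≈⟨ -0#≈0# ⟩
    0#             ∎)

  TorsionFree : Set _
  TorsionFree = ∀ n → 0 < n → Regular (n ·ℕ 1#)

  -- Writing n = m + (d + 1), the difference is -(d + 1), the negative of a positive integer.
  regular-ℕ-difference : TorsionFree → ∀ {m n} → m < n → Regular (m ·ℕ 1# - n ·ℕ 1#)
  regular-ℕ-difference torsionFree {m} {n} m<n with d , 1+m+d≡n ← ℕ.m≤n⇒∃[o]m+o≡n m<n =
    regular-resp-≈ (sym difference) (regular-neg (torsionFree (suc d) (s≤s z≤n)))
    where
    difference : m ·ℕ 1# - n ·ℕ 1# ≈ - (suc d ·ℕ 1#)
    difference = begin
      m ·ℕ 1# - n ·ℕ 1#
        ≈⟨ +-congˡ (-‿cong (×-congˡ (≡.trans (≡.sym 1+m+d≡n) (≡.sym (ℕ.+-suc m d))))) ⟩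
      m ·ℕ 1# - (m ℕ.+ suc d) ·ℕ 1#
        ≈⟨ +-congˡ (-‿cong (×-homo-+ 1# m (suc d))) ⟩
      m ·ℕ 1# - (m ·ℕ 1# + suc d ·ℕ 1#)
        ≈⟨ +-congˡ (-‿+-comm _ _) ⟨
      m ·ℕ 1# + (- (m ·ℕ 1#) - suc d ·ℕ 1#)
        ≈⟨ +-assoc _ _ _ ⟨
      (m ·ℕ 1# - m ·ℕ 1#) - suc d ·ℕ 1#
        ≈⟨ +-congʳ (-‿inverseʳ _) ⟩
      0# - suc d ·ℕ 1#
        ≈⟨ +-identityˡ _ ⟩
      - (suc d ·ℕ 1#) ∎

-- Iterated derivatives and operators with a single term.

module PolynomialLemmas {c e} (K : CommutativeRing c e) (ℓ : ℕ) where

  open Polynomials K ℓ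
  module K = CommutativeRing K
  module S = CommutativeRing S
  open CommutativeRingLemmas K using (Regular; regular-1; regular-*)

  derivatives : List (Fin ℓ) → Poly → Poly
  derivatives is f = foldr ∂ f is

  derivatives-cong : ∀ is {f g} → f ≋ g → derivatives is f ≋ derivatives is g
  derivatives-cong []       p = p
  derivatives-cong (i ∷ is) p = ∂-cong i (derivatives-cong is p)

  -- The single derivatives that make up `∂^ γ`, in the same nesting order. For |γ| = 2 this is a
  -- list of two indices, which spares a case analysis on the shape of γ.
  word : Vec ℕ ℓ → List (Fin ℓ)
  word γ = List.concatMap (λ i → replicate (lookup γ i) i) (allFin ℓ)

  fold-replicate : ∀ i k f → fold f (∂ i) k ≡ derivatives (replicate k i) f
  fold-replicate i zero    f = ≡.refl
  fold-replicate i (suc k) f = ≡.cong (∂ i) (fold-replicate i k f)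

  ∂^-word : ∀ γ f → ∂^ γ f ≡ derivatives (word γ) f
  ∂^-word γ f = go (allFin ℓ)
    where
    go : ∀ is → foldr (λ i g → fold g (∂ i) (lookup γ i)) f is
              ≡ derivatives (List.concatMap (λ i → replicate (lookup γ i) i) is) f
    go []       = ≡.refl
    go (i ∷ is) = ≡.trans (≡.cong (λ g → fold g (∂ i) (lookup γ i)) (go is))
      (≡.trans (fold-replicate i (lookup γ i) _)
        (≡.sym (foldr-++ ∂ f (replicate (lookup γ i) i) _)))

  length-word : ∀ γ → List.length (word γ) ≡ Vec.sum γ
  length-word γ = ≡.trans (go (allFin ℓ))
    (≡.trans (≡.cong ListAction.sum (map-tabulate id (lookup γ))) (sum-lookup γ))
    where
    go : ∀ is → List.length (List.concatMap (λ i → replicate (lookup γ i) i) is)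
              ≡ ListAction.sum (List.map (lookup γ) is)
    go []       = ≡.refl
    go (i ∷ is) = ≡.trans (length-++ (replicate (lookup γ i) i))
      (≡.cong₂ ℕ._+_ (length-replicate (lookup γ i)) (go is))

    sum-lookup : ∀ {n} (δ : Vec ℕ n) → ListAction.sum (List.tabulate (lookup δ)) ≡ Vec.sum δ
    sum-lookup []      = ≡.refl
    sum-lookup (k ∷ δ) = ≡.cong (k ℕ.+_) (sum-lookup δ)

  ∂^-cong : ∀ γ {f g} → f ≋ g → ∂^ γ f ≋ ∂^ γ g
  ∂^-cong γ {f} {g} p rewrite ∂^-word γ f | ∂^-word γ g = derivatives-cong (word γ) p

  module _ {a} {X : Set a} where

    weightedSum-congʳ : ∀ (f : X → Poly) {h k} → (∀ x → h x ≋ k x) → ∀ xs →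
                        weightedSum f h xs ≋ weightedSum f k xs
    weightedSum-congʳ f p []       = refl
    weightedSum-congʳ f p (x ∷ xs) = +-cong (*-cong refl (p x)) (weightedSum-congʳ f p xs)

    weightedSum-congˡ : ∀ {f g : X → Poly} h → (∀ x → f x ≋ g x) → ∀ xs →
                        weightedSum f h xs ≋ weightedSum g h xs
    weightedSum-congˡ h p []       = refl
    weightedSum-congˡ h p (x ∷ xs) = +-cong (*-cong (p x) refl) (weightedSum-congˡ h p xs)

    weightedSum-all-0 : ∀ {f : X → Poly} h {xs} → All (λ x → f x ≋ S.0#) xs →
                        weightedSum f h xs ≋ S.0#
    weightedSum-all-0 h []       = refl
    weightedSum-all-0 h (p ∷ ps) =
      trans (+-cong (trans (*-cong p refl) (S.zeroˡ _)) (weightedSum-all-0 h ps)) (+-identity _)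

    weightedSum-single : ∀ {f : X → Poly} h {x xs} → (∀ y → y ≢ x → f y ≋ S.0#) →
                         x ∈ xs → Unique xs → weightedSum f h xs ≋ f x :* h x
    weightedSum-single {f} h f≋0 (here ≡.refl) (x∉xs ∷ _) = trans
      (+-cong refl (weightedSum-all-0 h (All.map (λ x≢y → f≋0 _ (x≢y ∘ ≡.sym)) x∉xs)))
      (S.+-identityʳ _)
    weightedSum-single {f} h f≋0 (there x∈xs) (y∉xs ∷ unique) = trans
      (+-cong (trans (*-cong (f≋0 _ (All.lookup y∉xs x∈xs)) refl) (S.zeroˡ _))
              (weightedSum-single h f≋0 x∈xs unique))
      (+-identity _)

  apply-congʳ : ∀ {m} (θ : DiffOp m) {f g} → f ≋ g → apply θ f ≋ apply θ g
  apply-congʳ {m} θ p = weightedSum-congʳ θ (λ γ → ∂^-cong (proj₁ γ) p) (multiIndices ℓ m)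

  -- The operator g ∂^γ. Comparing exponent vectors suffices, because proofs of |γ| = m are unique.
  monomialOp : ∀ {m} → MultiIndex ℓ m → Poly → DiffOp m
  monomialOp (γ , _) g (δ , _) with ≡-dec ℕ._≟_ δ γ
  ... | yes _ = g
  ... | no  _ = S.0#

  monomialOp-≡ : ∀ {m} (γ : MultiIndex ℓ m) g → monomialOp γ g γ ≡ g
  monomialOp-≡ (γ , _) g with ≡-dec ℕ._≟_ γ γ
  ... | yes _  = ≡.refl
  ... | no γ≢γ = contradiction ≡.refl γ≢γ

  monomialOp-≢ : ∀ {m} (γ : MultiIndex ℓ m) g δ → δ ≢ γ → monomialOp γ g δ ≋ S.0#
  monomialOp-≢ (γ , p) g (δ , q) δ≢γ with ≡-dec ℕ._≟_ δ γ
  ... | yes ≡.refl = contradiction (≡.cong (δ ,_) (ℕ.≡-irrelevant q p)) δ≢γ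
  ... | no  _      = refl

  apply-monomialOp : ∀ {m} (γ : MultiIndex ℓ m) g f →
                     apply (monomialOp γ g) f ≋ g :* ∂^ (proj₁ γ) f
  apply-monomialOp {m} γ g f = trans
    (weightedSum-single (λ δ → ∂^ (proj₁ δ) f) (monomialOp-≢ γ g)
      (multiIndices-complete γ) (multiIndices-unique ℓ m))
    (S.*-congʳ (S.reflexive (monomialOp-≡ γ g)))

  -- Q ∂^γ sends every polynomial into QS, with cofactor ∂^γ f. This provides the element Q ∂₀² of
  -- D⁽²⁾(𝒜).
  monomialOp-stabilises : ∀ {m} Q (γ : MultiIndex ℓ m) → Stabilises Q (monomialOp γ Q)
  monomialOp-stabilises Q γ f _ =
    ∂^ (proj₁ γ) f ,∣ trans (*-comm _ _) (sym (apply-monomialOp γ Q f))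

  eval-product-regular : ∀ v {k} (f : Vector Poly k) →
    (∀ i → Regular (eval v (f i))) → Regular (eval v (product f))
  eval-product-regular v {zero}  f reg = regular-1
  eval-product-regular v {suc k} f reg =
    regular-* (reg zero) (eval-product-regular v (f ∘ suc) (reg ∘ suc))

-- The reflection in x₀ = x₁ and its linear form α.

module SwapInvariants {c e} (K : CommutativeRing c e) (n : ℕ) where

  ℓ : ℕ
  ℓ = suc (suc n)

  open Polynomials K ℓ
  open PolynomialLemmas K ℓ
  open CommutativeRingLemmas K
  module SP = RingProperties S.ring
  module KP = RingProperties K.ring
  open Mult K.semiring using (×-homo-+) renaming (_×_ to _·ℕ_)
  open SetoidReasoning K.setoid
  open SemiringSolver K.commutativeSemiring using (solve; _:=_)
    renaming (_:+_ to _⊕_; _:*_ to _⊗_)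

  swap : SignedPermutation ℓ
  swap = ⊥ ◂ transpose 0F 1F

  swap∈W : ∀ T → swap ∈W T
  swap∈W A = ≡.refl
  swap∈W B = tt
  swap∈W D = ≡.subst (2 ∣_) (≡.sym (∣⊥∣≡0 ℓ)) (2 ∣0)

  α : Poly
  α = var 0F S.- var 1F

  -- The swap sends α to -α, and the two signs cancel.
  swap-α² : swap ⁻¹ · (α :* α) ≋ α :* α
  swap-α² = trans (*-cong swapped swapped) (trans (sym (SP.-‿distribˡ-* _ _))
    (trans (-‿cong (sym (SP.-‿distribʳ-* _ _))) (SP.-‿involutive _)))
    where
    swapped : var 1F S.- var 0F ≋ :- α
    swapped = trans (+-comm _ _)
      (trans (+-cong refl (sym (SP.-‿involutive _))) (SP.-‿+-comm _ _))

  -- The flips of an inverse are tabulated through the permutation, so at an unknown index the sign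
  -- in `act` is stuck until rewritten with this.
  lookup-flips-swap⁻¹ : ∀ i → lookup (flips (swap ⁻¹)) i ≡ false
  lookup-flips-swap⁻¹ i = ≡.trans (lookup∘tabulate (lookup {n = ℓ} ⊥ ∘ (transpose 0F 1F ⟨$⟩ʳ_)) i)
    (lookup-replicate (transpose {ℓ} 0F 1F ⟨$⟩ʳ i) false)

  2e₀ : MultiIndex ℓ 2
  2e₀ = 2 ∷ Vec.replicate (suc n) 0 , ≡.cong (2 ℕ.+_) (sum-zeros n)
    where
    sum-zeros : ∀ k → Vec.sum (Vec.replicate k 0) ≡ 0
    sum-zeros zero    = ≡.refl
    sum-zeros (suc k) = sum-zeros k

  ∂^2e₀ : ∀ f → ∂^ (proj₁ 2e₀) f ≡ ∂ 0F (∂ 0F f)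
  ∂^2e₀ f = ≡.cong (λ g → ∂ 0F (∂ 0F g))
    -- The exponents at `0F` and `1F` compute; the remaining indices are the `suc (suc i)`.
    (no-derivatives (All.tabulate⁺ {f = λ i → suc (suc i)} (λ i → lookup-replicate i 0)))
    where
    no-derivatives : ∀ {is} → All (λ i → lookup (proj₁ 2e₀) i ≡ 0) is →
      foldr (λ i g → fold g (∂ i) (lookup (proj₁ 2e₀) i)) f is ≡ f
    no-derivatives []                   = ≡.refl
    no-derivatives (p ∷ ps) rewrite p   = no-derivatives ps

  -- Values and first derivatives at a point of the mirror.

  module AtMirrorPoint (v : Vector K.Carrier ℓ) (v₀≈v₁ : v 0F K.≈ v 1F) where

    -- The swap fixes v, as the first two coordinates of v agree.
    eval-swap : ∀ f → eval v (swap · f) K.≈ eval v f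
    eval-swap (con a)              = K.refl
    eval-swap (var 0F)             = K.sym v₀≈v₁
    eval-swap (var 1F)             = v₀≈v₁
    eval-swap (var i@(suc (suc _))) rewrite lookup-flips-swap⁻¹ i = K.refl
    eval-swap (f :+ g)             = K.+-cong (eval-swap f) (eval-swap g)
    eval-swap (f :* g)             = K.*-cong (eval-swap f) (eval-swap g)
    eval-swap (:- f)               = K.-‿cong (eval-swap f)

    -- By the chain rule ∂₀(s·f) = s·(∂₁f), and s fixes v.
    eval-∂-swap : ∀ f → eval v (∂ 0F (swap · f)) K.≈ eval v (∂ 1F f)
    eval-∂-swap (con a)              = K.refl
    eval-∂-swap (var 0F)             = K.refl
    eval-∂-swap (var 1F)             = K.refl
    eval-∂-swap (var i@(suc (suc _))) rewrite lookup-flips-swap⁻¹ i = K.refl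
    eval-∂-swap (f :+ g)             = K.+-cong (eval-∂-swap f) (eval-∂-swap g)
    eval-∂-swap (f :* g)             =
      K.+-cong (K.*-cong (eval-∂-swap f) (eval-swap g)) (K.*-cong (eval-swap f) (eval-∂-swap g))
    eval-∂-swap (:- f)               = K.-‿cong (eval-∂-swap f)

    eval-α : eval v α K.≈ K.0#
    eval-α = KP.x≈y⇒x∙y⁻¹≈ε v₀≈v₁

    -- The trace at v of θ(α²) for an invariant θ in D⁽²⁾(𝒜). The field `symmetric` says that the
    -- derivative of p across the mirror, along e₀ - e₁, is zero at v.
    record SymmetricJet (p : Poly) : Set e where
      constructor jet
      field
        vanishes  : eval v p K.≈ K.0#
        symmetric : eval v (∂ 0F p) K.≈ eval v (∂ 1F p)

    open SymmetricJet

    symmetricJet-resp-≋ : ∀ {p q} → p ≋ q → SymmetricJet p → SymmetricJet q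
    symmetricJet-resp-≋ p≋q (jet p≈0 sym-p) = jet
      (K.trans (K.sym (eval-cong v p≋q)) p≈0)
      (K.trans (K.sym (eval-cong v (∂-cong 0F p≋q)))
        (K.trans sym-p (eval-cong v (∂-cong 1F p≋q))))

    symmetricJet-0 : SymmetricJet S.0#
    symmetricJet-0 = jet K.refl K.refl

    symmetricJet-+ : ∀ {p q} → SymmetricJet p → SymmetricJet q → SymmetricJet (p :+ q)
    symmetricJet-+ (jet p≈0 sym-p) (jet q≈0 sym-q) =
      jet (K.trans (K.+-cong p≈0 q≈0) (K.+-identityˡ K.0#)) (K.+-cong sym-p sym-q)

    -- In the Leibniz rule the term (∂c) p dies because p vanishes at v. Symmetry of the derivatives
    -- alone would not survive multiplication by c.
    symmetricJet-* : ∀ c {p} → SymmetricJet p → SymmetricJet (c :* p)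
    symmetricJet-* c {p} (jet p≈0 sym-p) = jet (*p≈0 (eval v c))
      (K.+-cong (K.trans (*p≈0 (eval v (∂ 0F c))) (K.sym (*p≈0 (eval v (∂ 1F c)))))
              (K.*-congˡ sym-p))
      where
      *p≈0 : ∀ a → a K.* eval v p K.≈ K.0#
      *p≈0 a = K.trans (K.*-congˡ p≈0) (K.zeroʳ a)

    -- Two derivatives of α² h: whenever one of them falls on h, at most one is left for α², so a
    -- factor α remains and is zero at v.
    eval-derivatives-α² : ∀ h is → List.length is ≡ 2 →
      eval v (derivatives is ((α :* α) :* h)) K.≈ eval v h K.* eval v (derivatives is (α :* α))
    eval-derivatives-α² h (i ∷ j ∷ []) ≡.refl = begin
      eval v (∂ i (∂ j ((α :* α) :* h)))
        ≈⟨ leibniz (eval v α) (eval v (∂ i α)) (eval v (∂ j α)) (eval v (∂ i (∂ j α)))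
             (eval v h) (eval v (∂ i h)) (eval v (∂ j h)) (eval v (∂ i (∂ j h))) ⟩
      eval v h K.* eval v (∂ i (∂ j (α :* α))) K.+ eval v α K.* _
        ≈⟨ K.+-congˡ (K.trans (K.*-congʳ eval-α) (K.zeroˡ _)) ⟩
      eval v h K.* eval v (∂ i (∂ j (α :* α))) K.+ K.0#
        ≈⟨ K.+-identityʳ _ ⟩
      eval v h K.* eval v (∂ i (∂ j (α :* α))) ∎
      where
      -- The left side is what `∂ i (∂ j ((α :* α) :* h))` unfolds to under `eval v`; the right side
      -- collects the terms that keep a factor α.
      leibniz : ∀ a aᵢ aⱼ aᵢⱼ h hᵢ hⱼ hᵢⱼ → let open K in
        (((aᵢⱼ * a + aⱼ * aᵢ) + (aᵢ * aⱼ + a * aᵢⱼ)) * h + (aⱼ * a + a * aⱼ) * hᵢ)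
          + ((aᵢ * a + a * aᵢ) * hⱼ + (a * a) * hᵢⱼ)
        ≈ h * ((aᵢⱼ * a + aⱼ * aᵢ) + (aᵢ * aⱼ + a * aᵢⱼ))
          + a * ((aⱼ * hᵢ + aⱼ * hᵢ) + (aᵢ * hⱼ + aᵢ * hⱼ) + a * hᵢⱼ)
      leibniz = solve 8 (λ a aᵢ aⱼ aᵢⱼ h hᵢ hⱼ hᵢⱼ →
        (((aᵢⱼ ⊗ a ⊕ aⱼ ⊗ aᵢ) ⊕ (aᵢ ⊗ aⱼ ⊕ a ⊗ aᵢⱼ)) ⊗ h ⊕ (aⱼ ⊗ a ⊕ a ⊗ aⱼ) ⊗ hᵢ)
          ⊕ ((aᵢ ⊗ a ⊕ a ⊗ aᵢ) ⊗ hⱼ ⊕ (a ⊗ a) ⊗ hᵢⱼ)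
        := h ⊗ ((aᵢⱼ ⊗ a ⊕ aⱼ ⊗ aᵢ) ⊕ (aᵢ ⊗ aⱼ ⊕ a ⊗ aᵢⱼ))
          ⊕ a ⊗ ((aⱼ ⊗ hᵢ ⊕ aⱼ ⊗ hᵢ) ⊕ (aᵢ ⊗ hⱼ ⊕ aᵢ ⊗ hⱼ) ⊕ a ⊗ hᵢⱼ)) K.refl

    eval-∂^-α² : ∀ h (γ : MultiIndex ℓ 2) →
      eval v (∂^ (proj₁ γ) ((α :* α) :* h)) K.≈ eval v h K.* eval v (∂^ (proj₁ γ) (α :* α))
    eval-∂^-α² h (γ , ∣γ∣≡2)
      rewrite ∂^-word γ ((α :* α) :* h) | ∂^-word γ (α :* α) =
      eval-derivatives-α² h (word γ) (≡.trans (length-word γ) ∣γ∣≡2)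

    eval-apply-α² : ∀ (θ : DiffOp 2) h →
      eval v (apply θ ((α :* α) :* h)) K.≈ eval v h K.* eval v (apply θ (α :* α))
    eval-apply-α² θ h = go (multiIndices ℓ 2)
      where
      go : ∀ γs → eval v (weightedSum θ (λ γ → ∂^ (proj₁ γ) ((α :* α) :* h)) γs)
             K.≈ eval v h K.* eval v (weightedSum θ (λ γ → ∂^ (proj₁ γ) (α :* α)) γs)
      go []       = K.sym (K.zeroʳ _)
      go (γ ∷ γs) = K.trans (K.+-cong (K.*-congˡ (eval-∂^-α² h γ)) (go γs))
        (solve 4 (λ t h d s → t ⊗ (h ⊗ d) ⊕ h ⊗ s := h ⊗ (t ⊗ d ⊕ s)) K.refl
          (eval v (θ γ)) (eval v h) _ _)

    -- Consequences of a factorisation Q = α Q′ with Q′(v) regular.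

    module _ {Q Q′ : Poly} (Q≋αQ′ : Q ≋ α :* Q′) (regular : Regular (eval v Q′)) where

      eval-Q : eval v Q K.≈ K.0#
      eval-Q = K.trans (eval-cong v Q≋αQ′) (K.trans (K.*-congʳ eval-α) (K.zeroˡ _))

      stabilises⇒eval-apply-α² : ∀ θ → Stabilises Q θ → eval v (apply θ (α :* α)) K.≈ K.0#
      stabilises⇒eval-apply-α² θ stab
        with q ,∣ qQ≋θf ← stab ((α :* α) :* Q′)
               (α ,∣ trans (*-cong refl Q≋αQ′) (sym (*-assoc _ _ _))) =
        regular _ (begin
          eval v Q′ K.* eval v (apply θ (α :* α))  ≈⟨ eval-apply-α² θ Q′ ⟨
          eval v (apply θ ((α :* α) :* Q′))        ≈⟨ eval-cong v qQ≋θf ⟨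
          eval v q K.* eval v Q                    ≈⟨ K.*-congˡ eval-Q ⟩
          eval v q K.* K.0#                        ≈⟨ K.zeroʳ _ ⟩
          K.0#                                     ∎)

      invariant⇒symmetricJet : ∀ {T} θ → Stabilises Q θ → Invariant T θ →
                               SymmetricJet (apply θ (α :* α))
      invariant⇒symmetricJet {T} θ stab inv = jet (stabilises⇒eval-apply-α² θ stab)
        (K.trans (eval-cong v (∂-cong 0F (sym swap-fixes))) (eval-∂-swap (apply θ (α :* α))))
        where
        swap-fixes : swap · apply θ (α :* α) ≋ apply θ (α :* α)
        swap-fixes = trans (substitute-cong _ (apply-congʳ θ (sym swap-α²)))
                           (inv swap (swap∈W T) (α :* α))

      -- The map θ ↦ θ(α²) is S-linear, since coefficients multiply the derivatives from the left;
      -- the closure properties of `SymmetricJet` then apply term by term.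
      linearCombination-symmetricJet :
        ∀ {k} (c : Vector Poly k) (x : Vector (Module.Carrierᴹ (D⁽ 2 ⁾ Q)) k) →
        (∀ j → SymmetricJet (apply (proj₁ (x j)) (α :* α))) →
        SymmetricJet (apply (proj₁ (linearCombination (D⁽ 2 ⁾ Q) c x)) (α :* α))
      linearCombination-symmetricJet {zero}  c x jets =
        symmetricJet-resp-≋ (sym (weightedSum-0 _ (multiIndices ℓ 2))) symmetricJet-0
      linearCombination-symmetricJet {suc k} c x jets =
        symmetricJet-resp-≋
          (sym (trans (weightedSum-+ _ _ _ (multiIndices ℓ 2))
            (+-cong (weightedSum-* (c zero) _ _ (multiIndices ℓ 2)) refl)))
          (symmetricJet-+ (symmetricJet-* (c zero) (jets zero))
            (linearCombination-symmetricJet (c ∘ suc) (x ∘ suc) (jets ∘ suc)))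

      -- Q ∂₀² sends α² to α r with r = Q′ ∂₀²α². The derivatives of α r at v are r(v) and -r(v), so
      -- symmetry gives 2 r(v) = 0. Cancelling 2 and Q′(v) leaves ∂₀²α² = 2 = 0 at v, and cancelling
      -- 2 once more gives 1 = 0.
      symmetricJet-Q∂₀²⇒1≈0 : Regular (2 ·ℕ K.1#) →
        SymmetricJet (apply (monomialOp 2e₀ Q) (α :* α)) → K.1# K.≈ K.0#
      symmetricJet-Q∂₀²⇒1≈0 regular₂ Q∂₀²-jet = regular₂ K.1# (K.trans (K.*-identityʳ _)
        (K.trans (K.sym second-derivative) (regular _ (regular₂ _ double))))
        where
        open K using (_+_; _*_; -_; 0#; 1#)
        ∂₀²α² r : Poly
        ∂₀²α² = ∂ 0F (∂ 0F (α :* α))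
        r = Q′ :* ∂₀²α²

        1-0 : 1# + - 0# K.≈ 1#
        1-0 = K.trans (K.+-congˡ KP.-0#≈0#) (K.+-identityʳ 1#)

        -- The trailing zero is kept because `2 ·ℕ 1#` unfolds to `1# + (1# + 0#)`.
        -[0-1] : - (0# + - 1#) K.≈ 1# + 0#
        -[0-1] = K.trans (K.-‿cong (K.+-identityˡ _))
          (K.trans (KP.-‿involutive 1#) (K.sym (K.+-identityʳ 1#)))

        second-derivative : eval v ∂₀²α² K.≈ 2 ·ℕ 1#
        second-derivative = begin
          -- This is `eval v ∂₀²α²` unfolded: `1# + - 0#` is ∂₀α and `0# + - 0#` is ∂₀²α.
          ((0# + - 0#) * eval v α + (1# + - 0#) * (1# + - 0#))
            + ((1# + - 0#) * (1# + - 0#) + eval v α * (0# + - 0#))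
            ≈⟨ K.+-cong (K.+-cong (K.*-congˡ eval-α) (K.*-cong 1-0 1-0))
                        (K.+-cong (K.*-cong 1-0 1-0) (K.*-congʳ eval-α)) ⟩
          ((0# + - 0#) * 0# + 1# * 1#) + (1# * 1# + 0# * (0# + - 0#))
            ≈⟨ K.+-cong (K.trans (K.+-cong (K.zeroʳ _) (K.*-identityˡ 1#)) (K.+-identityˡ 1#))
                        (K.+-cong (K.*-identityˡ 1#) (K.zeroˡ _)) ⟩
          2 ·ℕ 1# ∎

        αr-jet : SymmetricJet (α :* r)
        αr-jet = symmetricJet-resp-≋
          (trans (apply-monomialOp 2e₀ Q (α :* α))
            (trans (*-cong Q≋αQ′ (S.reflexive (∂^2e₀ (α :* α)))) (*-assoc α Q′ ∂₀²α²))) Q∂₀²-jet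

        eval-∂-αr : ∀ i → eval v (∂ i (α :* r)) K.≈ eval v (∂ i α) * eval v r
        eval-∂-αr i = K.trans (K.+-congˡ (K.trans (K.*-congʳ eval-α) (K.zeroˡ _)))
                              (K.+-identityʳ _)

        double : 2 ·ℕ 1# * eval v r K.≈ 0#
        double = begin
          2 ·ℕ 1# * eval v r
            ≈⟨ K.distribʳ _ 1# (1# + 0#) ⟩
          1# * eval v r + (1# + 0#) * eval v r
            ≈⟨ K.+-cong (K.*-congʳ (K.sym 1-0)) (K.trans (K.*-congʳ (K.sym -[0-1]))
                 (K.sym (KP.-‿distribˡ-* _ _))) ⟩
          (1# + - 0#) * eval v r + - ((0# + - 1#) * eval v r)
            ≈⟨ KP.x≈y⇒x∙y⁻¹≈ε (K.trans (K.sym (eval-∂-αr 0F))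
                 (K.trans (symmetric αr-jet) (eval-∂-αr 1F))) ⟩
          0# ∎

      -- Spanning expresses Q ∂₀² through invariant elements, which forces a symmetric jet on its
      -- value at α².
      invariant-basis⇒1≈0 : Regular (2 ·ℕ K.1#) → ∀ {T} {I : Set}
        (b : I → Module.Carrierᴹ (D⁽ 2 ⁾ Q)) → IsBasis (D⁽ 2 ⁾ Q) b →
        (∀ i → Invariant T (proj₁ (b i))) → K.1# K.≈ K.0#
      invariant-basis⇒1≈0 regular₂ {T} b basis inv
        with k , is , c , combination ←
          IsBasis.spanning basis (monomialOp 2e₀ Q , monomialOp-stabilises Q 2e₀) =
        symmetricJet-Q∂₀²⇒1≈0 regular₂ (symmetricJet-resp-≋
          (weightedSum-congˡ _ combination (multiIndices ℓ 2))
          (linearCombination-symmetricJet c (b ∘ is) λ j →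
            invariant⇒symmetricJet {T} (proj₁ (b (is j))) (proj₂ (b (is j))) (inv (is j))))

    -- Only the pair (0, 1) contributes α. Every other pair i < j has j > 1, which is where
    -- regularity of the factor is demanded.
    ∏[i<j]-factor : ∀ g u → g 0F 1F ≋ α :* u → Regular (eval v u) →
      (∀ i j → toℕ i < toℕ j → 1 < toℕ j → Regular (eval v (g i j))) →
      ∃ λ Q′ → ∏[i<j] g ≋ α :* Q′ × Regular (eval v Q′)
    ∏[i<j]-factor g u g₀₁≋αu regular-u regular-g = (u :* row₀) :* rows ,
      -- The entry (0, 0) of the first row is the default value 1 and is removed first.
      trans (*-cong (trans (*-identity _)
              (trans (*-cong g₀₁≋αu refl) (*-assoc α u row₀))) refl) (*-assoc α _ rows) ,
      regular-* {eval v (u :* row₀)} (regular-* {eval v u} regular-u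
        (eval-product-regular v (λ j → factor 0F (suc (suc j))) λ j →
          regular-g 0F (suc (suc j)) (s≤s z≤n) (s≤s (s≤s z≤n))))
        (eval-product-regular v (λ i → product (factor (suc i))) λ i →
          eval-product-regular v (factor (suc i)) (entry i))
      where
      factor : Fin ℓ → Fin ℓ → Poly
      factor i j = if does (i <? j) then g i j else S.1#

      row₀ rows : Poly
      row₀ = product λ j → factor 0F (suc (suc j))
      rows = product λ i → product λ j → factor (suc i) j

      entry : ∀ i j → Regular (eval v (factor (suc i) j))
      entry i j = decided (suc i <? j)
        where
        decided : (suc-i<j? : Dec (toℕ (suc i) < toℕ j)) →
          Regular (eval v (if does suc-i<j? then g (suc i) j else S.1#))
        -- Below the first row 1 ≤ `suc i` < j, so j > 1.
        decided (yes i<j) = regular-g (suc i) j i<j (ℕ.≤-<-trans (s≤s z≤n) i<j)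
        decided (no  _)   = regular-1

  -- The maximum with 1 makes the first two coordinates both 1, which puts the point on the mirror.
  -- All coordinates are positive integers with no other coincidence, so the remaining factors xᵢ,
  -- xᵢ - xⱼ and xᵢ + xⱼ take regular values.
  mirrorPoint : Vector K.Carrier ℓ
  mirrorPoint i = (1 ℕ.⊔ toℕ i) ·ℕ K.1#

  open AtMirrorPoint mirrorPoint K.refl

  -- Splitting α off the defining polynomials of types A, B and D.

  module _ (torsionFree : TorsionFree) where

    1⊔i<1⊔j : ∀ {i j} → i < j → 1 < j → 1 ℕ.⊔ i < 1 ℕ.⊔ j
    1⊔i<1⊔j {i} {j} i<j 1<j = ℕ.<-≤-trans (ℕ.⊔-lub 1<j i<j) (ℕ.m≤n⊔m 1 j)

    coordinate-regular : ∀ i → Regular (mirrorPoint i)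
    coordinate-regular i = torsionFree _ (ℕ.m≤m⊔n 1 (toℕ i))

    difference-regular : ∀ i j → toℕ i < toℕ j → 1 < toℕ j →
      Regular (mirrorPoint i K.- mirrorPoint j)
    difference-regular i j i<j 1<j =
      regular-ℕ-difference torsionFree (1⊔i<1⊔j i<j 1<j)

    sum-regular : ∀ i j → Regular (mirrorPoint i K.+ mirrorPoint j)
    sum-regular i j = regular-resp-≈ (×-homo-+ K.1# (1 ℕ.⊔ toℕ i) (1 ℕ.⊔ toℕ j))
      (torsionFree _ (ℕ.≤-trans (ℕ.m≤m⊔n 1 (toℕ i)) (ℕ.m≤m+n _ _)))

    squares-regular : ∀ i j → toℕ i < toℕ j → 1 < toℕ j →
      Regular (mirrorPoint i K.* mirrorPoint i K.- mirrorPoint j K.* mirrorPoint j)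
    squares-regular i j i<j 1<j =
      regular-resp-≈ (K.sym (difference-of-squares (mirrorPoint i) (mirrorPoint j)))
        (regular-* (difference-regular i j i<j 1<j) (sum-regular i j))

    Q-factor : ∀ T → ∃ λ Q′ → Q T ≋ α :* Q′ × Regular (eval mirrorPoint Q′)
    Q-factor A = ∏[i<j]-factor (λ i j → var i S.- var j) S.1#
      (sym (S.*-identityʳ α)) regular-1 difference-regular
    -- Type B has the coordinate product as an extra factor; it is moved past α into the cofactor.
    Q-factor B with Q′ , eq , reg ← Q-factor D =
      product var :* Q′ ,
      trans (*-cong refl eq) (trans (sym (*-assoc _ _ _))
        (trans (*-cong (*-comm _ _) refl) (*-assoc _ _ _))) ,
      regular-* {eval mirrorPoint (product var)}
        (eval-product-regular mirrorPoint var coordinate-regular) reg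
    Q-factor D = ∏[i<j]-factor (λ i j → var i :* var i S.- var j :* var j) (var 0F :+ var 1F)
      (CommutativeRingLemmas.difference-of-squares S (var 0F) (var 1F))
      (sum-regular 0F 1F) squares-regular

    no-invariant-basis : ¬ (K.1# K.≈ K.0#) → ∀ T →
      ¬ (Σ Set λ I → Σ (I → Module.Carrierᴹ (D⁽ 2 ⁾ (Q T))) λ b →
           IsBasis (D⁽ 2 ⁾ (Q T)) b × (∀ i → Invariant T (proj₁ (b i))))
    no-invariant-basis 1≉0 T (I , b , basis , inv) =
      let Q′ , Q≋αQ′ , regular = Q-factor T
      in 1≉0 (invariant-basis⇒1≈0 Q≋αQ′ regular (torsionFree 2 (s≤s z≤n)) {T} b basis inv)

-- The real numbers are torsion-free and nontrivial.

module ℝ-Lemmas where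

  open CommutativeRing ℝ-commutativeRing using (1#; 0#; semiring)
  open CommutativeRingLemmas ℝ-commutativeRing
  open Mult semiring using () renaming (_×_ to _·ℕ_)
  open ℚ.≤-Reasoning

  seq-·ℕ-nonneg : ∀ n k → 0ℚ ℚ.≤ seq (n ·ℕ 1#) k
  seq-·ℕ-nonneg zero    k = ℚ.≤-refl
  seq-·ℕ-nonneg (suc n) k = ℚ.+-mono-≤ {0ℚ} {1ℚ} (ℚ.nonNegative⁻¹ 1ℚ) (seq-·ℕ-nonneg n k)

  -- Each term of the sequence for n + 1 is a rational at least 1, so the terms of x are bounded by
  -- those of the product, and the same N serves for ε.
  ℝ-torsionFree : TorsionFree
  ℝ-torsionFree (suc n) _ x nx≈0 ε ε>0 with N , small ← nx≈0 ε ε>0 =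
    N , λ k N≤k → let a = seq (suc n ·ℕ 1#) k; q = seq x k in begin-strict
      ℚ.∣ q ℚ.- 0ℚ ∣            ≡⟨ ≡.cong ℚ.∣_∣ (ℚ.+-identityʳ q) ⟩
      ℚ.∣ q ∣                   ≡⟨ ℚ.*-identityˡ ℚ.∣ q ∣ ⟨
      1ℚ ℚ.* ℚ.∣ q ∣            ≤⟨ ℚ.*-monoʳ-≤-nonNeg ℚ.∣ q ∣ {{ℚ.nonNegative (ℚ.0≤∣p∣ q)}}
                                     (1≤∣a∣ k) ⟩
      ℚ.∣ a ∣ ℚ.* ℚ.∣ q ∣       ≡⟨ ℚ.∣p*q∣≡∣p∣*∣q∣ a q ⟨
      ℚ.∣ a ℚ.* q ∣             ≡⟨ ≡.cong ℚ.∣_∣ (ℚ.+-identityʳ (a ℚ.* q)) ⟨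
      ℚ.∣ a ℚ.* q ℚ.- 0ℚ ∣      <⟨ small k N≤k ⟩
      ε                         ∎
    where
    1≤∣a∣ : ∀ k → 1ℚ ℚ.≤ ℚ.∣ seq (suc n ·ℕ 1#) k ∣
    1≤∣a∣ k = begin
      1ℚ                             ≡⟨ ℚ.+-identityʳ 1ℚ ⟨
      1ℚ ℚ.+ 0ℚ                      ≤⟨ ℚ.+-monoʳ-≤ 1ℚ (seq-·ℕ-nonneg n k) ⟩
      seq (suc n ·ℕ 1#) k            ≡⟨ ℚ.0≤p⇒∣p∣≡p (seq-·ℕ-nonneg (suc n) k) ⟨
      ℚ.∣ seq (suc n ·ℕ 1#) k ∣      ∎

  1≉0 : ¬ (1# ≈ℝ 0#)
  1≉0 1≈0 with N , small ← 1≈0 1ℚ (ℚ.positive⁻¹ 1ℚ) = ℚ.<-irrefl ≡.refl (small N ℕ.≤-refl)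

theorem6p5 : (T : ReflectionType) (ℓ : ℕ) → minRank T ≤ ℓ →
    let open RealPolynomials ℓ
        D²𝒜 = D⁽ 2 ⁾ (Q T)
    in ¬ (Σ Set λ I → Σ (I → Module.Carrierᴹ D²𝒜) λ b →
            IsBasis D²𝒜 b × (∀ i → Invariant T (proj₁ (b i))))
theorem6p5 T ℓ rank≤ℓ with 2≤ℓ T rank≤ℓ
  where
  2≤ℓ : ∀ T → minRank T ≤ ℓ → 2 ≤ ℓ
  2≤ℓ A p = p
  2≤ℓ B p = p
  2≤ℓ D p = ℕ.≤-trans (s≤s (s≤s z≤n)) p
-- Matching on 2 ≤ ℓ exhibits the two coordinates to be swapped.
... | s≤s (s≤s {n = n} _) =
  SwapInvariants.no-invariant-basis ℝ-commutativeRing n ℝ-Lemmas.ℝ-torsionFree ℝ-Lemmas.1≉0 T
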